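{- Let $G$ be a triangle-free cubic graph. Obtain a graph $H$ from $G$ by adding a new vertex $x$, joining $x$ by an edge to some vertex $y$ of $G$, and making $x$ adjacent to exactly two of the neighbors of $y$ in $G$. Then $H$ is $\mathrm{cl}$-expanding, i.e. $\lim_{k\to\infty}|V(\mathrm{cl}^k(H))|=\infty$.
   Context: Graphs are finite and simple. A claw in a graph $G$ is an induced subgraph of $G$ isomorphic to $K_{1,3}$. The claw graph $\mathrm{cl}(G)$ is the graph whose vertices are the claws in $G$, where two vertices are adjacent if and only if they are distinct claws sharing a common edge; if $G$ has no claw, $\mathrm{cl}(G)=\emptyset$, and $\mathrm{cl}(\emptyset)=\emptyset$. Iterates: $\mathrm{cl}^0(H)=H$, $\mathrm{cl}^k(H)=\mathrm{cl}(\mathrm{cl}^{k-1}(H))$. A cubic graph is a 3-regular graph; triangle-free means containing no subgraph isomorphic to $C_3$. -}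

module Defs where

open import Data.Nat using (ℕ; zero; suc; _<ᵇ_; _≤_)
open import Data.Fin using (Fin; zero; suc; toℕ; _≟_)
open import Data.Bool using (Bool; true; false; _∧_; _∨_; not; if_then_else_)
open import Data.List using (List; []; _∷_; length; filter; concatMap; allFin; lookup)
open import Data.Product using (_×_; _,_; ∃-syntax)
open import Relation.Nullary.Decidable using (⌊_⌋)
open import Relation.Binary.PropositionalEquality using (_≡_; _≢_)
open import Function using (_∘_)

record Graph : Set where
  constructor mkGraph
  field
    n   : ℕ
    adj : Fin n → Fin n → Bool
open Graph public

Fin' : Graph → Set
Fin' G = Fin (n G)

order : Graph → ℕ
order = Graph.n

IsSimple : Graph → Set
IsSimple G = (∀ u v → adj G u v ≡ adj G v u) × (∀ v → adj G v v ≡ false)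

_==_ : ∀ {n} → Fin n → Fin n → Bool
a == b = ⌊ a ≟ b ⌋

nbrs : (G : Graph) → Fin (n G) → List (Fin (n G))
nbrs G v = filter (λ u → adj G v u Data.Bool.≟ true) (allFin (n G))

IsCubic : Graph → Set
IsCubic G = ∀ v → length (nbrs G v) ≡ 3

-- no subgraph isomorphic to C3 (in a simple graph the three vertices are distinct)
IsTriangleFree : Graph → Set
IsTriangleFree G = ∀ a b c → adj G a b ≡ true → adj G b c ≡ true → adj G a c ≡ false

-- A claw is recorded as (centre c, leaves a < b < d); every induced K_{1,3}
-- arises from exactly one such quadruple.
Claw : ℕ → Set
Claw n = Fin n × Fin n × Fin n × Fin n

isClaw : (G : Graph) → Claw (n G) → Bool
isClaw G (c , a , b , d) =
  (toℕ a <ᵇ toℕ b) ∧ (toℕ b <ᵇ toℕ d)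
  ∧ not (c == a) ∧ not (c == b) ∧ not (c == d)
  ∧ adj G c a ∧ adj G c b ∧ adj G c d
  ∧ not (adj G a b) ∧ not (adj G a d) ∧ not (adj G b d)

claws : (G : Graph) → List (Claw (n G))
claws G = filter (λ q → isClaw G q Data.Bool.≟ true)
  (concatMap (λ c → concatMap (λ a → concatMap (λ b → Data.List.map (λ d → (c , a , b , d))
     (allFin (n G))) (allFin (n G))) (allFin (n G))) (allFin (n G)))

sameEdge : ∀ {n} → Fin n × Fin n → Fin n × Fin n → Bool
sameEdge (p , q) (r , s) = (p == r ∧ q == s) ∨ (p == s ∧ q == r)

clawEdges : ∀ {n} → Claw n → List (Fin n × Fin n)
clawEdges (c , a , b , d) = (c , a) ∷ (c , b) ∷ (c , d) ∷ []

anyB : ∀ {A : Set} → (A → Bool) → List A → Bool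
anyB p [] = false
anyB p (x ∷ xs) = p x ∨ anyB p xs

shareEdge : ∀ {n} → Claw n → Claw n → Bool
shareEdge k l = anyB (λ e → anyB (sameEdge e) (clawEdges l)) (clawEdges k)

cl : Graph → Graph
cl G = mkGraph (length (claws G))
  (λ i j → not (i == j) ∧ shareEdge (lookup (claws G) i) (lookup (claws G) j))

clIter : ℕ → Graph → Graph
clIter zero H = H
clIter (suc k) H = cl (clIter k H)

ClExpanding : Graph → Set
ClExpanding H = ∀ M → ∃[ K ] ∀ k → K ≤ k → M ≤ order (clIter k H)

extend : (G : Graph) → Fin (n G) → Fin (n G) → Fin (n G) → Graph
extend G y u w = mkGraph (suc (n G)) A
  where
  xAdj : Fin (n G) → Bool
  xAdj v = v == y ∨ v == u ∨ v == w
  A : Fin (suc (n G)) → Fin (suc (n G)) → Bool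
  A zero zero = false
  A zero (suc v) = xAdj v
  A (suc v) zero = xAdj v
  A (suc a) (suc b) = adj G a b

{-# OPTIONS --safe #-}
module Submission where

-- For a vertex v of the copy of G in K, the claw centred at v on its three neighbours in G is a vertex
-- of cl K, and these claws induce a copy of G again. Let x be a vertex outside the copy that sees, in
-- G, exactly a vertex y and two of its neighbours u and w. Then replacing y by x in the claws at u and
-- at w gives two claws, and each of them is a vertex of cl K outside the new copy that sees u
-- (respectively w) and all of its neighbours but y. So the number of such vertices doubles at
-- every step, whatever the edges between them are.

open import Defs
open import Data.Bool using (Bool; true; false; _∧_; _∨_; not)
import Data.Bool.Properties as Bool
open import Data.Fin using (Fin; zero; suc; _<_; _≟_; cast; punchIn; remQuot; combine)
open import Data.Fin.Patterns using (0F; 1F; 2F)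
open import Data.Fin.Properties using (<-cmp; all?; any?; cast-is-id; punchInᵢ≢i; punchIn-injective; combine-remQuot; injective⇒≤; suc-injective)
open import Data.List using (List; []; _∷_; lookup; allFin)
open import Data.List.Membership.Propositional using (_∈_; find; lose)
open import Data.List.Membership.Propositional.Properties using (∈-filter⁺; ∈-filter⁻; ∈-concatMap⁺; ∈-map⁺; ∈-allFin; ∈-lookup)
import Data.List.Relation.Unary.All as All
open import Data.List.Relation.Unary.Any using (Any; here; there; index)
open import Data.List.Relation.Unary.Any.Properties using (map⁺; map⁻; lookup-index)
open import Data.List.Relation.Unary.AllPairs using (_∷_)
open import Data.List.Relation.Unary.Unique.Propositional using (Unique)
open import Data.List.Relation.Unary.Unique.Propositional.Properties using (filter⁺; allFin⁺)
open import Data.Nat using (ℕ; zero; suc; _*_; _^_; _<ᵇ_; z<s)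
import Data.Nat as ℕ
import Data.Nat.Properties as ℕ
open import Data.Product using (_×_; _,_; ∃; ∃₂; proj₁; proj₂)
open import Data.Sum using (_⊎_; inj₁; inj₂)
import Data.Sum as Sum
import Data.Vec as Vec
open import Data.Vec.Functional using (updateAt)
open import Data.Vec.Functional.Properties using (updateAt-updates; updateAt-minimal)
open import Function using (_∘_; Injective; _⇔_; mk⇔; Equivalence)
open import Relation.Binary using (tri<; tri≈; tri>)
open import Relation.Binary.PropositionalEquality using (_≡_; _≢_; refl; sym; trans; cong; cong₂; subst; subst₂)
open import Relation.Nullary using (¬_; yes; no; contradiction)
open import Relation.Nullary.Decidable using (Dec; ¬?; _×-dec_; _⊎-dec_; _→-dec_; from-yes; True; toWitness)

open Equivalence using (to; from)

-- Boolean tests read as propositions.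

∨-true⁻ : ∀ {a b} → a ∨ b ≡ true → a ≡ true ⊎ b ≡ true
∨-true⁻ {true}  _ = inj₁ refl
∨-true⁻ {false} p = inj₂ p

∨-true⁺ : ∀ {a b} → a ≡ true ⊎ b ≡ true → a ∨ b ≡ true
∨-true⁺         (inj₁ refl) = refl
∨-true⁺ {a = a} (inj₂ refl) = Bool.∨-zeroʳ a

∧-true⁻ : ∀ {a b} → a ∧ b ≡ true → a ≡ true × b ≡ true
∧-true⁻ {true} {true} _ = refl , refl

infixr 6 _∧⁺_
_∧⁺_ : ∀ {a b} → a ≡ true → b ≡ true → a ∧ b ≡ true
_∧⁺_ = cong₂ _∧_

not-true⁺ : ∀ {a} → a ≢ true → not a ≡ true
not-true⁺ = cong not ∘ Bool.¬-not

≡-true-⇔ : ∀ {a b} → (a ≡ true → b ≡ true) → (b ≡ true → a ≡ true) → a ≡ b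
≡-true-⇔ {true}          f g = sym (f refl)
≡-true-⇔ {false} {true}  f g = g refl
≡-true-⇔ {false} {false} f g = refl

==⁺ : ∀ {n} {a b : Fin n} → a ≡ b → (a == b) ≡ true
==⁺ {a = a} {b} p with a ≟ b
... | yes _  = refl
... | no a≢b = contradiction p a≢b

==⁻ : ∀ {n} {a b : Fin n} → (a == b) ≡ true → a ≡ b
==⁻ {a = a} {b} p with a ≟ b
... | yes q = q

≢⇒not== : ∀ {n} {a b : Fin n} → a ≢ b → not (a == b) ≡ true
≢⇒not== a≢b = not-true⁺ (a≢b ∘ ==⁻)

anyB⁺ : {A : Set} {p : A → Bool} {xs : List A} → Any (λ x → p x ≡ true) xs → anyB p xs ≡ true
anyB⁺ (here px)  = ∨-true⁺ (inj₁ px)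
anyB⁺ (there ps) = ∨-true⁺ (inj₂ (anyB⁺ ps))

anyB⁻ : {A : Set} {p : A → Bool} (xs : List A) → anyB p xs ≡ true → Any (λ x → p x ≡ true) xs
anyB⁻ (x ∷ xs) q with ∨-true⁻ q
... | inj₁ px = here px
... | inj₂ ps = there (anyB⁻ xs ps)

lookup-injective : {A : Set} {xs : List A} → Unique xs → ∀ {i j} → lookup xs i ≡ lookup xs j → i ≡ j
lookup-injective (_ ∷ _)     {zero}  {zero}  _  = refl
lookup-injective (x∉ ∷ _)    {zero}  {suc j} eq = contradiction eq (All.lookup x∉ (∈-lookup j))
lookup-injective (x∉ ∷ _)    {suc i} {zero}  eq = contradiction (sym eq) (All.lookup x∉ (∈-lookup i))
lookup-injective (_ ∷ uniq)  {suc i} {suc j} eq = cong suc (lookup-injective uniq eq)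

-- Sorting the three leaves of a claw.

Sorts : ∀ {n} → (Fin 3 → Fin n) → (Fin 3 → Fin 3) → Set
Sorts ℓ π = (∀ k → ∃ λ j → k ≡ π j) × ℓ (π 0F) < ℓ (π 1F) × ℓ (π 1F) < ℓ (π 2F)

sortingOrder : ∀ {n} (ℓ : Fin 3 → Fin n) → Injective _≡_ _≡_ ℓ → ∃ λ π → Sorts ℓ π
sortingOrder ℓ inj = sorted (compare {0F} {1F} λ ()) (compare {1F} {2F} λ ()) (compare {0F} {2F} λ ())
  where
  compare : ∀ {i j} → i ≢ j → ℓ i < ℓ j ⊎ ℓ j < ℓ i
  compare {i} {j} i≢j with <-cmp (ℓ i) (ℓ j)
  ... | tri< i<j _ _ = inj₁ i<j
  ... | tri≈ _ i≡j _ = contradiction (inj i≡j) i≢j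
  ... | tri> _ _ j<i = inj₂ j<i

  surjective? : (π : Fin 3 → Fin 3) → Dec (∀ k → ∃ λ j → k ≡ π j)
  surjective? π = all? λ k → any? λ j → k ≟ π j

  -- For a concrete order `a`, `b`, `c` the surjectivity test evaluates, so its `True` argument is
  -- filled in by unification.
  order-as : ∀ a b c → let π = Vec.lookup (a Vec.∷ b Vec.∷ c Vec.∷ Vec.[]) in
    {True (surjective? π)} → ℓ a < ℓ b → ℓ b < ℓ c → ∃ λ π → Sorts ℓ π
  order-as a b c {surj} a<b b<c = Vec.lookup (a Vec.∷ b Vec.∷ c Vec.∷ Vec.[]) , toWitness surj , a<b , b<c

  sorted : ℓ 0F < ℓ 1F ⊎ ℓ 1F < ℓ 0F → ℓ 1F < ℓ 2F ⊎ ℓ 2F < ℓ 1F → ℓ 0F < ℓ 2F ⊎ ℓ 2F < ℓ 0F →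
    ∃ λ π → Sorts ℓ π
  sorted (inj₁ p) (inj₁ q) _        = order-as 0F 1F 2F p q
  sorted (inj₁ p) (inj₂ q) (inj₁ r) = order-as 0F 2F 1F r q
  sorted (inj₁ p) (inj₂ q) (inj₂ r) = order-as 2F 0F 1F r p
  sorted (inj₂ p) (inj₁ q) (inj₁ r) = order-as 1F 0F 2F p r
  sorted (inj₂ p) (inj₁ q) (inj₂ r) = order-as 1F 2F 0F q r
  sorted (inj₂ p) (inj₂ q) _        = order-as 2F 1F 0F q p

-- Shared edges and adjacency in the claw graph.

Adj : (G : Graph) → Fin' G → Fin' G → Set
Adj G a b = adj G a b ≡ true

Adj-irrefl : ∀ {G} → IsSimple G → ∀ {a} → ¬ Adj G a a
Adj-irrefl (_ , irr) p = Bool.not-¬ (irr _) p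

Adj-sym : ∀ {G} → IsSimple G → ∀ {a b} → Adj G a b → Adj G b a
Adj-sym (symm , _) = trans (symm _ _)

centre : ∀ {n} → Claw n → Fin n
centre = proj₁

leaves : ∀ {n} → Claw n → List (Fin n)
leaves (_ , a , b , d) = a ∷ b ∷ d ∷ []

-- Every edge of a claw joins its centre to a leaf, so two such edges coincide either with the same
-- orientation or crosswise, each centre being a leaf of the other claw.
ShareEdge : ∀ {n} → Claw n → Claw n → Set
ShareEdge k l = ∃₂ λ x y → x ∈ leaves k × y ∈ leaves l ×
  (centre k ≡ centre l × x ≡ y ⊎ centre k ≡ y × x ≡ centre l)

ShareEdge-sym : ∀ {n} {k l : Claw n} → ShareEdge k l → ShareEdge l k
ShareEdge-sym (x , y , x∈ , y∈ , inj₁ (p , q)) = y , x , y∈ , x∈ , inj₁ (sym p , sym q)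
ShareEdge-sym (x , y , x∈ , y∈ , inj₂ (p , q)) = y , x , y∈ , x∈ , inj₂ (sym q , sym p)

shareEdge⁺ : ∀ {n} {k l : Claw n} → ShareEdge k l → shareEdge k l ≡ true
shareEdge⁺ {k = k} {l} (x , y , x∈ , y∈ , e) =
  anyB⁺ {p = λ e → anyB (sameEdge e) (clawEdges l)} (map⁺ {f = centre k ,_} (lose {xs = leaves k} x∈
    (anyB⁺ {p = sameEdge (centre k , x)} (map⁺ {f = centre l ,_} (lose {xs = leaves l} y∈
      (∨-true⁺ (Sum.map both both e)))))))
  where
  both : ∀ {n} {a b c d : Fin n} → a ≡ b × c ≡ d → (a == b) ∧ (c == d) ≡ true
  both (p , q) = ==⁺ p ∧⁺ ==⁺ q

shareEdge⁻ : ∀ {n} (k l : Claw n) → shareEdge k l ≡ true → ShareEdge k l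
shareEdge⁻ k l p with find (map⁻ {xs = leaves k}
                              (anyB⁻ {p = λ e → anyB (sameEdge e) (clawEdges l)} (clawEdges k) p))
... | x , x∈ , q with find (map⁻ {xs = leaves l} (anyB⁻ {p = sameEdge (centre k , x)} (clawEdges l) q))
... | y , y∈ , e = x , y , x∈ , y∈ , Sum.map both both (∨-true⁻ e)
  where
  both : ∀ {n} {a b c d : Fin n} → (a == b) ∧ (c == d) ≡ true → a ≡ b × c ≡ d
  both r = let s , t = ∧-true⁻ r in ==⁻ s , ==⁻ t

clawAt : (K : Graph) → Fin' (cl K) → Claw (n K)
clawAt K = lookup (claws K)

cl-Adj⁺ : ∀ K i j → i ≢ j → ShareEdge (clawAt K i) (clawAt K j) → Adj (cl K) i j
cl-Adj⁺ K i j i≢j s = ≢⇒not== i≢j ∧⁺ shareEdge⁺ {k = clawAt K i} {clawAt K j} s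

cl-Adj⁻ : ∀ K i j → Adj (cl K) i j → i ≢ j × ShareEdge (clawAt K i) (clawAt K j)
cl-Adj⁻ K i j p =
  let i≠j , s = ∧-true⁻ p
  in (λ i≡j → Bool.not-¬ (==⁺ i≡j) (Bool.not-injective i≠j))
   , shareEdge⁻ (clawAt K i) (clawAt K j) s

cl-simple : ∀ K → IsSimple (cl K)
cl-simple K = (λ i j → ≡-true-⇔ (symm i j) (symm j i)) , λ i → Bool.¬-not (λ p → proj₁ (cl-Adj⁻ K i i p) refl)
  where
  symm : ∀ i j → Adj (cl K) i j → Adj (cl K) j i
  symm i j p = let i≢j , s = cl-Adj⁻ K i j p in
    cl-Adj⁺ K j i (i≢j ∘ sym) (ShareEdge-sym {k = clawAt K i} {clawAt K j} s)

-- Stars with labelled leaves and the claws they give.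

record Star (K : Graph) (c : Fin' K) (ℓ : Fin 3 → Fin' K) : Set where
  field
    injective   : Injective _≡_ _≡_ ℓ
    spoke       : ∀ k → Adj K c (ℓ k)
    independent : ∀ k l → ¬ Adj K (ℓ k) (ℓ l)

-- Leaves are compared as a set, so later arguments can name them by `ℓ` and forget the increasing
-- order in which the claw stores them.
record Depicts {n} (q : Claw n) (c : Fin n) (ℓ : Fin 3 → Fin n) : Set where
  field
    centre≡ : centre q ≡ c
    leaf⁺   : ∀ k → ℓ k ∈ leaves q
    leaf⁻   : ∀ {x} → x ∈ leaves q → ∃ λ k → x ≡ ℓ k

claw-index : ∀ K q → isClaw K q ≡ true → ∃ λ i → clawAt K i ≡ q
claw-index K q@(c , a , b , d) p = index q∈ , sym (lookup-index q∈)
  where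
  q∈ : q ∈ claws K
  q∈ = ∈-filter⁺ _ (∈-concatMap⁺ _ (lose (∈-allFin c) (∈-concatMap⁺ _ (lose (∈-allFin a)
         (∈-concatMap⁺ _ (lose (∈-allFin b) (∈-map⁺ _ (∈-allFin d)))))))) p

star-claw : ∀ {K} → IsSimple K → ∀ {c ℓ} → Star K c ℓ → ∃ λ i → Depicts (clawAt K i) c ℓ
star-claw {K} simple {c} {ℓ} st = proj₁ found , subst (λ q → Depicts q c ℓ) (sym (proj₂ found)) depicts
  where
  open Star st
  π    = proj₁ (sortingOrder ℓ injective)
  surj = proj₁ (proj₂ (sortingOrder ℓ injective))
  0<1  = proj₁ (proj₂ (proj₂ (sortingOrder ℓ injective)))
  1<2  = proj₂ (proj₂ (proj₂ (sortingOrder ℓ injective)))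

  q : Claw (n K)
  q = c , ℓ (π 0F) , ℓ (π 1F) , ℓ (π 2F)

  <⇒<ᵇ : ∀ {a b} → a ℕ.< b → (a <ᵇ b) ≡ true
  <⇒<ᵇ = to Bool.T-≡ ∘ ℕ.<⇒<ᵇ

  c≢ : ∀ k → not (c == ℓ k) ≡ true
  c≢ k = ≢⇒not== (λ c≡ → Adj-irrefl {K} simple (subst (Adj K c) (sym c≡) (spoke k)))

  found : ∃ λ i → clawAt K i ≡ q
  found = claw-index K q (<⇒<ᵇ 0<1 ∧⁺ <⇒<ᵇ 1<2
    ∧⁺ c≢ (π 0F) ∧⁺ c≢ (π 1F) ∧⁺ c≢ (π 2F)
    ∧⁺ spoke (π 0F) ∧⁺ spoke (π 1F) ∧⁺ spoke (π 2F)
    ∧⁺ not-true⁺ (independent (π 0F) (π 1F))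
    ∧⁺ not-true⁺ (independent (π 0F) (π 2F))
    ∧⁺ not-true⁺ (independent (π 1F) (π 2F)))

  position : ∀ j → ℓ (π j) ∈ leaves q
  position 0F = here refl
  position 1F = there (here refl)
  position 2F = there (there (here refl))

  depicts : Depicts q c ℓ
  depicts = record
    { centre≡ = refl
    ; leaf⁺   = λ k → let j , k≡ = surj k in subst (λ h → ℓ h ∈ leaves q) (sym k≡) (position j)
    ; leaf⁻   = λ where
        (here p)                 → π 0F , p
        (there (here p))         → π 1F , p
        (there (there (here p))) → π 2F , p
    }

module _ {n} {q r : Claw n} {c d : Fin n} {ℓ m : Fin 3 → Fin n} (Q : Depicts q c ℓ) (R : Depicts r d m) where
  private
    module Q = Depicts Q
    module R = Depicts R

  -- When the centres agree, the common leaf is dropped: the centres alone settle that case in both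
  -- adjacency computations below.
  depicted-ShareEdge⁻ : ShareEdge q r → c ≡ d ⊎ (∃₂ λ k l → c ≡ m l × ℓ k ≡ d)
  depicted-ShareEdge⁻ (x , y , _  , _  , inj₁ (p , _)) = inj₁ (trans (sym Q.centre≡) (trans p R.centre≡))
  depicted-ShareEdge⁻ (x , y , x∈ , y∈ , inj₂ (p , e)) =
    let k , x≡ = Q.leaf⁻ x∈ ; l , y≡ = R.leaf⁻ y∈
    in inj₂ (k , l , trans (sym Q.centre≡) (trans p y≡) , trans (sym x≡) (trans e R.centre≡))

  depicted-same-centre : ∀ {k l} → c ≡ d → ℓ k ≡ m l → ShareEdge q r
  depicted-same-centre {k} {l} p e =
    _ , _ , Q.leaf⁺ k , R.leaf⁺ l , inj₁ (trans Q.centre≡ (trans p (sym R.centre≡)) , e)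

  depicted-crossing : ∀ {k l} → c ≡ m l → ℓ k ≡ d → ShareEdge q r
  depicted-crossing {k} {l} p e =
    _ , _ , Q.leaf⁺ k , R.leaf⁺ l , inj₂ (trans Q.centre≡ p , trans e (sym R.centre≡))

-- Settled by checking all pairs. It finds the neighbour of `y` that the added vertex misses.
thirdElement : ∀ (a b : Fin 3) → a ≢ b →
  ∃ λ k → a ≢ k × b ≢ k × (∀ l → l ≢ k → l ≡ a ⊎ l ≡ b)
thirdElement = from-yes (all? λ a → all? λ b → thirdElement? a b)
  where
  thirdElement? : (a b : Fin 3) → Dec (a ≢ b → ∃ λ k → a ≢ k × b ≢ k × (∀ l → l ≢ k → l ≡ a ⊎ l ≡ b))
  thirdElement? a b = ¬? (a ≟ b) →-dec any? λ k →
    ¬? (a ≟ k) ×-dec ¬? (b ≟ k) ×-dec all? λ l → ¬? (l ≟ k) →-dec ((l ≟ a) ⊎-dec (l ≟ b))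

-- Neighbours and darts in a triangle-free cubic graph.

module Expansion (G : Graph) (simple : IsSimple G) (cubic : IsCubic G) (tri-free : IsTriangleFree G) where

  V : Set
  V = Fin' G

  no-triangle : ∀ {a b c} → Adj G a b → Adj G b c → ¬ Adj G a c
  no-triangle p q = Bool.not-¬ (tri-free _ _ _ p q)

  -- Numbering the neighbours of every vertex by the same `Fin 3` lets a leaf be replaced by its
  -- position.
  nbr : V → Fin 3 → V
  nbr v k = lookup (nbrs G v) (cast (sym (cubic v)) k)

  nbr-injective : ∀ v → Injective _≡_ _≡_ (nbr v)
  nbr-injective v {k} {l} eq = cast-injective (lookup-injective (filter⁺ _ (allFin⁺ (n G))) eq)
    where
    cast-injective : ∀ {a b} .{e : a ≡ b} {k l : Fin a} → cast e k ≡ cast e l → k ≡ l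
    cast-injective {suc _} {suc _} {k = zero}  {zero}  _ = refl
    cast-injective {suc _} {suc _} {k = suc k} {suc l} p = cong suc (cast-injective (suc-injective p))

  nbr-Adj : ∀ v k → Adj G v (nbr v k)
  nbr-Adj v k = proj₂ (∈-filter⁻ (λ u → adj G v u Bool.≟ true) {xs = allFin (n G)} (∈-lookup (cast (sym (cubic v)) k)))

  nbr-surjective : ∀ {v u} → Adj G v u → ∃ λ k → u ≡ nbr v k
  nbr-surjective {v} {u} p =
    cast (cubic v) (index u∈) , trans (lookup-index u∈) (cong (lookup (nbrs G v)) (sym (cast-cast (cubic v))))
    where
    u∈ : u ∈ nbrs G v
    u∈ = ∈-filter⁺ _ (∈-allFin u) p
    cast-cast : ∀ {a b} (e : a ≡ b) {k : Fin a} → cast (sym e) (cast e k) ≡ k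
    cast-cast refl = trans (cast-is-id refl _) (cast-is-id refl _)

  nbr-back : ∀ v k → ∃ λ l → v ≡ nbr (nbr v k) l
  nbr-back v k = nbr-surjective (Adj-sym {G} simple (nbr-Adj v k))

  -- The pair `(y , k)` is the edge at `y` directed towards `nbr y k`.
  Dart : Set
  Dart = V × Fin 3

  -- The closed neighbourhood of the tail minus the head. An added vertex of type (y , k) has exactly
  -- these neighbours in G.
  Sees : Dart → V → Set
  Sees (y , k) v = v ≡ y ⊎ ∃ λ l → l ≢ k × v ≡ nbr y l

  -- `punchIn k` runs through the two neighbours of `y` other than the head; from such a neighbour
  -- `u` the next dart points back to `y`, the leaf that is replaced in the claw at `u`.
  next : Dart → Fin 2 → Dart
  next (y , k) j = let u = nbr y (punchIn k j) in u , proj₁ (nbr-back y (punchIn k j))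

  -- The invariant of the iteration: an induced copy of `G` in `K` and `m` distinct further
  -- vertices, each attached to the copy as its dart prescribes. Several of them may carry the same
  -- dart.
  record Extended (K : Graph) (m : ℕ) : Set where
    field
      K-simple  : IsSimple K
      emb       : V → Fin' K
      emb-inj   : Injective _≡_ _≡_ emb
      emb-Adj   : ∀ {u v} → Adj K (emb u) (emb v) ⇔ Adj G u v
      ext       : Fin m → Fin' K
      ext-inj   : Injective _≡_ _≡_ ext
      dart      : Fin m → Dart
      ext-Adj   : ∀ {i v} → Adj K (ext i) (emb v) ⇔ Sees (dart i) v

  -- One application of `cl` doubles the added vertices.

  module Step {K m} (E : Extended K m) where
    open Extended E

    -- An added vertex sees both `y` and a neighbour of `y`, which are adjacent; a vertex of the
    -- copy doing so would lie in a triangle of `G`.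
    ext≢emb : ∀ {i v} → ext i ≢ emb v
    ext≢emb {i} {v} eq = no-triangle (v~ (inj₁ refl)) (nbr-Adj y l) (v~ (inj₂ (l , punchInᵢ≢i k 0F , refl)))
      where
      y = proj₁ (dart i)
      k = proj₂ (dart i)
      l = punchIn k 0F
      v~ : ∀ {u} → Sees (dart i) u → Adj G v u
      v~ s = to emb-Adj (subst (λ x → Adj K x (emb _)) eq (from ext-Adj s))

    old-star : ∀ v → Star K (emb v) (emb ∘ nbr v)
    old-star v = record
      { injective   = nbr-injective v ∘ emb-inj
      ; spoke       = λ k → from emb-Adj (nbr-Adj v k)
      ; independent = λ k l p → no-triangle (nbr-Adj v k) (to emb-Adj p) (nbr-Adj v l)
      }

    -- The claw at `u` with the leaf `y`, which stands at position `b`, replaced by `ext i`.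
    module New (i : Fin m) (j : Fin 2) where
      y = proj₁ (dart i)
      k = punchIn (proj₂ (dart i)) j
      u = nbr y k
      b = proj₁ (nbr-back y k)

      y≡ : y ≡ nbr u b
      y≡ = proj₂ (nbr-back y k)

      leaf : Fin 3 → Fin' K
      leaf = updateAt (emb ∘ nbr u) b (λ _ → ext i)

      leaf-back : leaf b ≡ ext i
      leaf-back = updateAt-updates b (emb ∘ nbr u)

      leaf-other : ∀ {l} → l ≢ b → leaf l ≡ emb (nbr u l)
      leaf-other {l} = updateAt-minimal l b (emb ∘ nbr u)

      leaf-ext : ∀ {i′ l} → leaf l ≡ ext i′ → i ≡ i′
      leaf-ext {l = l} eq with l ≟ b
      ... | yes refl = ext-inj (trans (sym leaf-back) eq)
      ... | no l≢b   = contradiction (trans (sym eq) (leaf-other l≢b)) ext≢emb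

      leaf-emb : ∀ {l v} → leaf l ≡ emb v → l ≢ b × v ≡ nbr u l
      leaf-emb {l} eq with l ≟ b
      ... | yes refl = contradiction (trans (sym leaf-back) eq) ext≢emb
      ... | no l≢b   = l≢b , emb-inj (trans (sym eq) (leaf-other l≢b))

      -- Within the copy, `ext i` sees only `y` and neighbours of `y`. Another neighbour of `u` is
      -- not `y`, and if it were adjacent to `y` it would close a triangle with `y` and `u`.
      ext≁other : ∀ {l} → l ≢ b → ¬ Adj K (ext i) (emb (nbr u l))
      ext≁other {l} l≢b p with to ext-Adj p
      ... | inj₁ l≡y         = l≢b (nbr-injective u (trans l≡y y≡))
      ... | inj₂ (h , _ , e) =
        no-triangle (nbr-Adj y k) (subst (Adj G u) e (nbr-Adj u l)) (nbr-Adj y h)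

      star : Star K (emb u) leaf
      star = record { injective = injective ; spoke = spoke ; independent = independent }
        where
        injective : Injective _≡_ _≡_ leaf
        injective {l} {h} eq with l ≟ b | h ≟ b
        ... | yes refl | yes refl = refl
        ... | yes refl | no h≢b   = contradiction (trans (sym leaf-back) (trans eq (leaf-other h≢b))) ext≢emb
        -- Both positions of `h` are covered: `leaf-emb` shows that a leaf lying in the copy is not
        -- the replaced one.
        ... | no l≢b   | _        =
          sym (nbr-injective u (sym (proj₂ (leaf-emb (trans (sym eq) (leaf-other l≢b))))))

        spoke : ∀ l → Adj K (emb u) (leaf l)
        spoke l with l ≟ b
        ... | yes refl = subst (Adj K (emb u)) (sym leaf-back)
          (Adj-sym {K} K-simple (from ext-Adj (inj₂ (k , punchInᵢ≢i _ j , refl))))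
        ... | no l≢b   = subst (Adj K (emb u)) (sym (leaf-other l≢b)) (from emb-Adj (nbr-Adj u l))

        independent : ∀ l h → ¬ Adj K (leaf l) (leaf h)
        independent l h p with l ≟ b | h ≟ b
        ... | yes refl | yes refl = Adj-irrefl {K} K-simple p
        ... | yes refl | no h≢b   = ext≁other h≢b (subst₂ (Adj K) leaf-back (leaf-other h≢b) p)
        ... | no l≢b   | yes refl =
          ext≁other l≢b (Adj-sym {K} K-simple (subst₂ (Adj K) (leaf-other l≢b) leaf-back p))
        ... | no l≢b   | no h≢b   =
          Star.independent (old-star u) l h (subst₂ (Adj K) (leaf-other l≢b) (leaf-other h≢b) p)

    oldV : V → Fin' (cl K)
    oldV v = proj₁ (star-claw {K} K-simple (old-star v))

    old : ∀ v → Depicts (clawAt K (oldV v)) (emb v) (emb ∘ nbr v)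
    old v = proj₂ (star-claw {K} K-simple (old-star v))

    newV : Fin m → Fin 2 → Fin' (cl K)
    newV i j = proj₁ (star-claw {K} K-simple (New.star i j))

    new : ∀ i j → Depicts (clawAt K (newV i j)) (emb (New.u i j)) (New.leaf i j)
    new i j = proj₂ (star-claw {K} K-simple (New.star i j))

    oldV-injective : Injective _≡_ _≡_ oldV
    oldV-injective {v} {v′} eq = emb-inj (trans (sym (Depicts.centre≡ (old v)))
      (trans (cong (centre ∘ clawAt K) eq) (Depicts.centre≡ (old v′))))

    -- Equal centres would make the two claws equal, so the claws can only share an edge crosswise,
    -- and that edge is the one between `v` and `v′`.
    oldV-Adj : ∀ {v v′} → Adj (cl K) (oldV v) (oldV v′) ⇔ Adj G v v′
    oldV-Adj {v} {v′} = mk⇔ forth back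
      where
      forth : Adj (cl K) (oldV v) (oldV v′) → Adj G v v′
      forth p = Sum.[ (λ e → contradiction (cong oldV (emb-inj e)) (proj₁ (cl-Adj⁻ K (oldV v) (oldV v′) p)))
                    , (λ (k , _ , _ , e) → subst (Adj G v) (emb-inj e) (nbr-Adj v k))
                    ] (depicted-ShareEdge⁻ (old v) (old v′) (proj₂ (cl-Adj⁻ K (oldV v) (oldV v′) p)))

      back : Adj G v v′ → Adj (cl K) (oldV v) (oldV v′)
      back p = cl-Adj⁺ K (oldV v) (oldV v′)
        (λ e → Adj-irrefl {G} simple (subst (Adj G v) (sym (oldV-injective e)) p))
        (depicted-crossing (old v) (old v′)
          (cong emb (proj₂ (nbr-surjective (Adj-sym {G} simple p))))
          (cong emb (sym (proj₂ (nbr-surjective p)))))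

    -- The index `i` is read off the only leaf outside the copy; with `i` known, the centre
    -- determines `j`.
    newV-injective : ∀ {i j i′ j′} → newV i j ≡ newV i′ j′ → i ≡ i′ × j ≡ j′
    newV-injective {i} {j} {i′} {j′} eq = i≡i′ , j≡j′ i≡i′
      where
      ext∈ : ext i ∈ leaves (clawAt K (newV i′ j′))
      ext∈ = subst (λ x → ext i ∈ leaves (clawAt K x)) eq
        (subst (_∈ leaves (clawAt K (newV i j))) (New.leaf-back i j) (Depicts.leaf⁺ (new i j) _))

      i≡i′ : i ≡ i′
      i≡i′ = sym (New.leaf-ext i′ j′ (sym (proj₂ (Depicts.leaf⁻ (new i′ j′) ext∈))))

      u≡u′ : New.u i j ≡ New.u i′ j′
      u≡u′ = emb-inj (trans (sym (Depicts.centre≡ (new i j)))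
        (trans (cong (centre ∘ clawAt K) eq) (Depicts.centre≡ (new i′ j′))))

      j≡j′ : i ≡ i′ → j ≡ j′
      j≡j′ refl = punchIn-injective (proj₂ (dart i)) j j′ (nbr-injective _ u≡u′)

    -- The leaf `ext i` lies outside the copy, whereas all leaves of an old claw lie inside it.
    newV≢oldV : ∀ {i j v} → newV i j ≢ oldV v
    newV≢oldV {i} {j} {v} eq = ext≢emb (trans (sym (New.leaf-back i j))
      (proj₂ (Depicts.leaf⁻ (old v)
        (subst (λ x → New.leaf i j _ ∈ leaves (clawAt K x)) eq (Depicts.leaf⁺ (new i j) _)))))

    -- The edge from `u` to `ext i` lies in no old claw. The two kept edges lie in the old claw at
    -- `u` and, crosswise, in those at the two kept leaves.
    newV-Adj : ∀ {i j v} → Adj (cl K) (newV i j) (oldV v) ⇔ Sees (next (dart i) j) v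
    newV-Adj {i} {j} {v} = mk⇔ forth back
      where
      open New i j

      forth : Adj (cl K) (newV i j) (oldV v) → Sees (u , b) v
      forth p = Sum.map (sym ∘ emb-inj) (λ (l , _ , _ , e) → l , leaf-emb e)
        (depicted-ShareEdge⁻ (new i j) (old v) (proj₂ (cl-Adj⁻ K (newV i j) (oldV v) p)))

      back : Sees (u , b) v → Adj (cl K) (newV i j) (oldV v)
      back (inj₁ refl) = cl-Adj⁺ K (newV i j) (oldV v) newV≢oldV
        -- `punchIn b 0F` is a position other than `b`, so its leaf survives the replacement and is
        -- common to both claws at `u`.
        (depicted-same-centre (new i j) (old v) refl (leaf-other (punchInᵢ≢i b 0F)))
      back (inj₂ (l , l≢b , refl)) = cl-Adj⁺ K (newV i j) (oldV v) newV≢oldV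
        (depicted-crossing (new i j) (old v) (cong emb (proj₂ (nbr-back u l))) (leaf-other l≢b))

    extended : Extended (cl K) (2 * m)
    extended = record
      { K-simple = cl-simple K
      ; emb      = oldV
      ; emb-inj  = oldV-injective
      ; emb-Adj  = λ {v} {v′} → oldV-Adj {v} {v′}
      ; ext      = λ h → newV (parent h) (branch h)
      -- An index below `2 * m` encodes a pair of branch and parent; `combine` recovers it from its
      -- components.
      ; ext-inj  = λ {h} {h′} eq → let i≡ , j≡ = newV-injective eq in
          trans (sym (combine-remQuot {2} m h))
            (trans (cong₂ combine j≡ i≡) (combine-remQuot {2} m h′))
      ; dart     = λ h → next (dart (parent h)) (branch h)
      ; ext-Adj  = λ {h} {v} → newV-Adj {parent h} {branch h} {v}
      }
      where
      parent : Fin (2 * m) → Fin m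
      parent h = proj₂ (remQuot {2} m h)
      branch : Fin (2 * m) → Fin 2
      branch h = proj₁ (remQuot {2} m h)

  -- `2 ^ suc k` and `clIter (suc k) K` unfold to `2 * 2 ^ k` and `cl (clIter k K)`, so each step
  -- applies without conversion.
  iterate : ∀ {K} → Extended K 1 → ∀ k → Extended (clIter k K) (2 ^ k)
  iterate E zero    = E
  iterate E (suc k) = Step.extended (iterate E k)

  -- The starting graph: `x` as the single added vertex.

  module _ {y u w : V} (y~u : Adj G y u) (y~w : Adj G y w) (u≢w : u ≢ w) where

    private
      H = extend G y u w
      a = proj₁ (nbr-surjective y~u)
      b = proj₁ (nbr-surjective y~w)
      u≡ = proj₂ (nbr-surjective y~u)
      w≡ = proj₂ (nbr-surjective y~w)
      -- The position of the neighbour of `y` not joined to `x`; it becomes the head of the initial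
      -- dart.
      missing = thirdElement a b (λ a≡b → u≢w (trans u≡ (trans (cong (nbr y) a≡b) (sym w≡))))
      d : Dart
      d = y , proj₁ missing

      H-sym : ∀ p q → adj H p q ≡ adj H q p
      H-sym zero    zero    = refl
      H-sym zero    (suc q) = refl
      H-sym (suc p) zero    = refl
      H-sym (suc p) (suc q) = proj₁ simple p q

      H-irrefl : ∀ p → adj H p p ≡ false
      H-irrefl zero    = refl
      H-irrefl (suc p) = proj₂ simple p

      x-Adj⁻ : ∀ {v} → Adj H zero (suc v) → Sees d v
      x-Adj⁻ p = Sum.map ==⁻
        (λ q → Sum.[ (λ v≡u → a , proj₁ (proj₂ missing) , trans (==⁻ v≡u) u≡)
                   , (λ v≡w → b , proj₁ (proj₂ (proj₂ missing)) , trans (==⁻ v≡w) w≡)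
                   ]′ (∨-true⁻ q))
        (∨-true⁻ p)

      x-Adj⁺ : ∀ {v} → Sees d v → Adj H zero (suc v)
      x-Adj⁺ (inj₁ v≡y) = ∨-true⁺ (inj₁ (==⁺ v≡y))
      x-Adj⁺ {v} (inj₂ (l , l≢k , v≡)) = ∨-true⁺ {v == y} (inj₂ (∨-true⁺ (Sum.map
        (λ l≡a → ==⁺ (trans v≡ (trans (cong (nbr y) l≡a) (sym u≡))))
        (λ l≡b → ==⁺ (trans v≡ (trans (cong (nbr y) l≡b) (sym w≡))))
        (proj₂ (proj₂ (proj₂ missing)) l l≢k))))

    extend-Extended : Extended H 1
    extend-Extended = record
      { K-simple = H-sym , H-irrefl
      ; emb      = suc
      ; emb-inj  = suc-injective
      -- Between successors, adjacency in `H` computes to adjacency in `G`.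
      ; emb-Adj  = mk⇔ (λ p → p) (λ p → p)
      ; ext      = λ _ → zero
      ; ext-inj  = λ { {zero} {zero} _ → refl }
      ; dart     = λ _ → d
      ; ext-Adj  = mk⇔ x-Adj⁻ x-Adj⁺
      }

-- Growth of the order.

n<2^n : ∀ n → n ℕ.< 2 ^ n
n<2^n zero    = z<s
n<2^n (suc n) = ℕ.≤-trans (ℕ.+-mono-≤ (ℕ.m^n>0 2 n) (n<2^n n))
  -- `2 ^ suc n` unfolds to `2 ^ n + (2 ^ n + 0)`, whence the final zero.
  (ℕ.+-monoʳ-≤ (2 ^ n) (ℕ.m≤m+n (2 ^ n) 0))

theorem4 : (G : Graph) → IsSimple G → IsCubic G → IsTriangleFree G →
    (y u w : Fin' G) → adj G y u ≡ true → adj G y w ≡ true → u ≢ w →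
    ClExpanding (extend G y u w)
-- `M` itself serves as the threshold: for `k` at least `M`, the injection `ext` gives `2 ^ k`
-- distinct vertices, and `2 ^ k` exceeds `k`.
theorem4 G simple cubic tri-free y u w y~u y~w u≢w M = M , λ k M≤k →
  ℕ.≤-trans M≤k (ℕ.≤-trans (ℕ.<⇒≤ (n<2^n k))
    (injective⇒≤ (Extended.ext-inj (iterate (extend-Extended y~u y~w u≢w) k))))
  where open Expansion G simple cubic tri-free
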